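{- Let $k\ge 1$ be an integer and let $G$ be a graph on $n \geq 2(k-1) + 2^{2(k-1)} + 1$ vertices. Then $G$ has an induced subgraph $H$ with $2k$ vertices that is (isomorphic to) a letter graph $\Gamma_D(w)$ on the word $$w = \ell_1\, \ell_2 \cdots \ell_k\, \ell_k \cdots \ell_2\, \ell_1$$ of length $2k$ over the $k$-letter alphabet $\{\ell_1,\dots,\ell_k\}$, for some decoder $D\subseteq\{\ell_1,\dots,\ell_k\}^2$. Thus, $\ell(G) \leq n - k$.
   Context: All graphs are finite and simple. Given a finite alphabet $\Sigma$, a decoder is a set of ordered pairs $D\subseteq\Sigma^2$. For a word $w$ with letters $w(1),\dots,w(n)\in\Sigma$, the letter graph $\Gamma_D(w)$ is the graph with vertex set $\{1,\dots,n\}$ and with an edge $ij$ for each $i<j$ such that $(w(i),w(j))\in D$. If $|\Sigma|=k$, then $\Gamma_D(w)$ is called a $k$-letter graph. The lettericity $\ell(G)$ of a graph $G$ is the least integer $k$ such that $G$ is isomorphic to a $k$-letter graph. -}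

module Defs where

open import Data.Bool.Base using (Bool; T)
open import Data.Bool.Properties using (T?)
open import Data.Fin.Base using (Fin; _<_)
open import Data.Fin.Properties using (_<?_; <-irrefl)
open import Data.Nat.Base using (ℕ; _+_; _≤_)
open import Data.Product.Base using (Σ; ∃-syntax; _×_; _,_; proj₁)
open import Data.Sum.Base using (_⊎_; swap; [_,_])
open import Data.Vec.Functional using (Vector; _++_; reverse)
open import Function.Base using (_∘_; id; _on_)
open import Function.Bundles using (_↔_; _⇔_; Inverse)
open import Level using (0ℓ)
open import Relation.Binary.Core using (Rel)
open import Relation.Binary.Definitions using (Decidable; Symmetric)
open import Relation.Binary.PropositionalEquality.Core using (refl)
open import Relation.Nullary.Decidable using (_×-dec_; _⊎-dec_)
open import Relation.Nullary.Negation.Core using (¬_)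

-- Adjacency is required to be decidable, which is automatic classically.
-- Finiteness is expressed separately, by a bijection V ↔ Fin n.
record Graph (V : Set) : Set₁ where
  field
    _~_    : Rel V 0ℓ
    _~?_   : Decidable _~_
    ~-sym  : Symmetric _~_
    ~-irr  : ∀ {v} → ¬ (v ~ v)

record _≅_ {V W : Set} (G : Graph V) (H : Graph W) : Set where
  private
    module G = Graph G
    module H = Graph H
  field
    bijection : V ↔ W
  open Inverse bijection public using (to; from)
  field
    ~⇔~ : ∀ u v → (u G.~ v) ⇔ (to u H.~ to v)

infix 4 _≅_

-- Vertex subsets are Boolean predicates, so that membership is decidable and
-- proof-irrelevant.
⟦_⟧ : {V : Set} → (V → Bool) → Set
⟦_⟧ {V} S = Σ V (T ∘ S)

_[_] : {V : Set} → Graph V → (S : V → Bool) → Graph ⟦ S ⟧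
G [ S ] = record
  { _~_   = _~_ on proj₁
  ; _~?_  = λ u v → proj₁ u ~? proj₁ v
  ; ~-sym = ~-sym
  ; ~-irr = ~-irr
  } where open Graph G

Decoder : Set → Set
Decoder A = A × A → Bool

module _ {A : Set} (D : Decoder A) {n : ℕ} (w : Vector A n) where

  Arc : Rel (Fin n) 0ℓ
  Arc i j = i < j × T (D (w i , w j))

  arc? : Decidable Arc
  arc? i j = (i <? j) ×-dec T? (D (w i , w j))

  arc-irr : ∀ {i} → ¬ Arc i i
  arc-irr (i<i , _) = <-irrefl refl i<i

  letterGraph : Graph (Fin n)
  letterGraph = record
    { _~_   = λ i j → Arc i j ⊎ Arc j i
    ; _~?_  = λ i j → arc? i j ⊎-dec arc? j i
    ; ~-sym = swap
    ; ~-irr = [ arc-irr , arc-irr ]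
    }

IsLetterGraph : ℕ → {V : Set} → Graph V → Set
IsLetterGraph k G =
  ∃[ n ] Σ (Decoder (Fin k)) λ D → Σ (Vector (Fin k) n) λ w →
    G ≅ letterGraph D w

-- The relation ℓ(G) = k.
Lettericity : {V : Set} → Graph V → ℕ → Set
Lettericity G k = IsLetterGraph k G × (∀ j → IsLetterGraph j G → k ≤ j)

-- ℓ₁ ℓ₂ ⋯ ℓₖ ℓₖ ⋯ ℓ₂ ℓ₁, over the alphabet Fin k.
nestedWord : ∀ k → Vector (Fin k) (k + k)
nestedWord k = id ++ reverse id

{-# OPTIONS --safe #-}
-- Choose pairs (aᵢ , bᵢ) one after the other so that aⱼ and bⱼ have the same
-- neighbours among the vertices of all earlier pairs: after j pairs there are
-- only 2^(2j) possible neighbourhoods in them, so the pigeonhole principle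
-- yields the next pair.  Such a family spells ℓ₁ ⋯ ℓₖ ℓₖ ⋯ ℓ₁, with (ℓᵢ , ℓⱼ) in
-- the decoder iff aᵢ ~ bⱼ.  Giving each remaining vertex a letter of its own and
-- placing these letters in the middle of the word spells G with n − k letters.
-- The least number of letters exists constructively because spelling G with c
-- letters is a finite search.
module Submission where

open import Data.Bool.Base using (Bool; true; false; T)
open import Data.Bool.Properties using (T?; T-irrelevant)
open import Data.Fin.Base
  using (Fin; zero; suc; toℕ; _<_; _>_; _↑ˡ_; _↑ʳ_; splitAt; join; opposite;
         punchOut; combine; remQuot; funToFin; finToFun)
open import Data.Fin.Permutation as Perm using (Permutation′; insert; insert-punchIn; ↔⇒≡)
open import Data.Fin.Properties
  using (_≟_; _<?_; <-cmp; <⇒≢; any?; all?; pigeonhole; toℕ<n; toℕ-↑ˡ; toℕ-↑ʳ;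
         splitAt-↑ˡ; splitAt-↑ʳ; splitAt-join; join-splitAt; opposite-prop;
         opposite-involutive; punchIn-punchOut; combine-injective;
         remQuot-combine; finToFun-funToFin; 2↔Bool)
open import Data.Nat.Base as ℕ using (ℕ; zero; suc; _+_; _*_; _∸_; _^_; _≤_; _≥_; z≤n; s≤s)
import Data.Nat.Properties as ℕ
open import Data.Nat.Tactic.RingSolver using (solve-∀)
open import Data.Product.Base using (Σ; ∃-syntax; _×_; _,_; proj₁; proj₂)
open import Data.Sum.Base using (_⊎_; inj₁; inj₂; [_,_])
open import Data.Vec.Functional using (Vector)
open import Function.Base using (_∘_)
open import Function.Bundles using (_↔_; _⇔_; mk↔ₛ′; mk⇔; Inverse; Equivalence)
open import Function.Properties.Equivalence using (⇔-isEquivalence)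
open import Function.Properties.Inverse using (↔-sym; ↔-trans)
open import Relation.Binary.Core using (Rel)
open import Relation.Binary.Definitions using (tri<; tri≈; tri>)
open import Relation.Binary.PropositionalEquality
  using (_≡_; _≢_; _≗_; refl; sym; trans; cong; cong₂; subst; subst₂)
open import Relation.Binary.Structures using (module IsEquivalence)
open import Relation.Nullary.Decidable
  using (Dec; yes; no; map′; isYes; toWitness; fromWitness; _×-dec_; _→-dec_)
open import Relation.Nullary.Negation using (¬_; contradiction)
open import Defs

open Inverse using (to; from; strictlyInverseˡ; strictlyInverseʳ)
private
  module ⇔ {ℓ} = IsEquivalence (⇔-isEquivalence {ℓ})

-- Slots of the word ℓ₁ ⋯ ℓₖ c₁ ⋯ cₘ ℓₖ ⋯ ℓ₁.  The argument of back is the index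
-- of the letter, so it decreases from left to right.
data Slot (k m : ℕ) : Set where
  front : Fin k → Slot k m
  middle : Fin m → Slot k m
  back : Fin k → Slot k m

private
  variable
    k m n N : ℕ
    A V : Set

-- Slots and their positions in the word

opposite-anti-< : {i j : Fin n} → i < j → opposite j < opposite i
opposite-anti-< {n} {i} {j} i<j
  rewrite opposite-prop i | opposite-prop j = ℕ.∸-monoʳ-< (s≤s i<j) (toℕ<n j)

opposite-cancel-< : {i j : Fin n} → opposite i < opposite j → j < i
opposite-cancel-< {i = i} {j} lt =
  subst₂ _<_ (opposite-involutive j) (opposite-involutive i) (opposite-anti-< lt)

position : Slot k m → Fin (k + (m + k))
position {k} {m} (front i) = i ↑ˡ (m + k)
position {k} {m} (middle c) = k ↑ʳ (c ↑ˡ k)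
position {k} {m} (back i) = k ↑ʳ (m ↑ʳ opposite i)

slot₂ : Fin m ⊎ Fin k → Slot k m
slot₂ = [ middle , back ∘ opposite ]

slot₁ : Fin k ⊎ Fin (m + k) → Slot k m
slot₁ {m = m} = [ front , slot₂ ∘ splitAt m ]

slot : Fin (k + (m + k)) → Slot k m
slot {k} = slot₁ ∘ splitAt k

slot-position : (s : Slot k m) → slot (position s) ≡ s
slot-position {k} {m} (front i) = cong slot₁ (splitAt-↑ˡ k i (m + k))
slot-position {k} {m} (middle c) =
  trans (cong slot₁ (splitAt-↑ʳ k (m + k) (c ↑ˡ k))) (cong slot₂ (splitAt-↑ˡ m c k))
slot-position {k} {m} (back i) =
  trans (cong slot₁ (splitAt-↑ʳ k (m + k) (m ↑ʳ opposite i)))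
  (trans (cong slot₂ (splitAt-↑ʳ m k (opposite i))) (cong back (opposite-involutive i)))

position-slot : (p : Fin (k + (m + k))) → position {k} {m} (slot p) ≡ p
position-slot {k} {m} p = trans (lemma (splitAt k p)) (join-splitAt k (m + k) p)
  where
  lemma₂ : ∀ x → position {k} {m} (slot₂ x) ≡ k ↑ʳ join m k x
  lemma₂ (inj₁ c) = refl
  lemma₂ (inj₂ i) = cong (λ z → k ↑ʳ (m ↑ʳ z)) (opposite-involutive i)

  lemma : ∀ x → position {k} {m} (slot₁ x) ≡ join k (m + k) x
  lemma (inj₁ i) = refl
  lemma (inj₂ r) = trans (lemma₂ (splitAt m r)) (cong (k ↑ʳ_) (join-splitAt m k r))

slot↔ : Fin (k + (m + k)) ↔ Slot k m
slot↔ {k} {m} = mk↔ₛ′ slot position slot-position (position-slot {k} {m})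

↑ˡ-cancel-< : {i j : Fin m} → i ↑ˡ n < j ↑ˡ n → i < j
↑ˡ-cancel-< {n = n} {i} {j} = subst₂ ℕ._<_ (toℕ-↑ˡ i n) (toℕ-↑ˡ j n)

↑ʳ-cancel-< : ∀ m {i j : Fin n} → m ↑ʳ i < m ↑ʳ j → i < j
↑ʳ-cancel-< m {i} {j} lt =
  ℕ.+-cancelˡ-< m _ _ (subst₂ ℕ._<_ (toℕ-↑ʳ m i) (toℕ-↑ʳ m j) lt)

↑ʳ≮↑ˡ : {i : Fin n} {j : Fin m} → ¬ (m ↑ʳ i < j ↑ˡ n)
↑ʳ≮↑ˡ {n} {m} {i} {j} lt = ℕ.<⇒≱ lt
  (subst₂ ℕ._≤_ (sym (toℕ-↑ˡ j n)) (sym (toℕ-↑ʳ m i))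
    (ℕ.≤-trans (ℕ.<⇒≤ (toℕ<n j)) (ℕ.m≤m+n m (toℕ i))))

-- Letters of slots and rearrangements of slots

letter : Slot k m → Fin k ⊎ Fin m
letter (front i) = inj₁ i
letter (middle c) = inj₂ c
letter (back i) = inj₁ i

first last : Fin k ⊎ Fin m → Slot k m
first = [ front , middle ]
last = [ back , middle ]

-- The recursion gives the newest pair index zero, whereas in the word the earliest pair is
-- outermost; this reversal reconciles the two orders.
reverseOuter : Slot k m ↔ Slot k m
reverseOuter = mk↔ₛ′ rev rev rev-rev rev-rev
  where
  rev : Slot k m → Slot k m
  rev (front i) = front (opposite i)
  rev (middle c) = middle c
  rev (back i) = back (opposite i)

  rev-rev : ∀ s → rev {k} {m} (rev s) ≡ s
  rev-rev (front i) = cong front (opposite-involutive i)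
  rev-rev (middle c) = refl
  rev-rev (back i) = cong back (opposite-involutive i)

permuteMiddle : Permutation′ m → Slot k m ↔ Slot k m
permuteMiddle {m} {k} π = mk↔ₛ′ (act (π Perm.⟨$⟩ʳ_)) (act (π Perm.⟨$⟩ˡ_))
  (act-inverse (λ _ → Perm.inverseʳ π)) (act-inverse (λ _ → Perm.inverseˡ π))
  where
  act : (Fin m → Fin m) → Slot k m → Slot k m
  act f (front i) = front i
  act f (middle c) = middle (f c)
  act f (back i) = back i

  act-inverse : ∀ {f g} → (∀ c → f (g c) ≡ c) → ∀ s → act f (act g s) ≡ s
  act-inverse fg (front i) = refl
  act-inverse fg (middle c) = cong middle (fg c)
  act-inverse fg (back i) = refl

-- Used to promote the two leading middle slots to a new pair of index zero; the older pairs move up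
-- by one.
pairOff : Slot (suc k) m ↔ Slot k (2 + m)
pairOff = mk↔ₛ′ f g
  (λ { (front i) → refl ; (middle zero) → refl ; (middle (suc zero)) → refl
     ; (middle (suc (suc c))) → refl ; (back i) → refl })
  (λ { (front zero) → refl ; (front (suc i)) → refl ; (middle c) → refl
     ; (back zero) → refl ; (back (suc i)) → refl })
  where
  f : Slot (suc k) m → Slot k (2 + m)
  f (front zero) = middle zero
  f (front (suc i)) = front i
  f (middle c) = middle (suc (suc c))
  f (back zero) = middle (suc zero)
  f (back (suc i)) = back i

  g : Slot k (2 + m) → Slot (suc k) m
  g (front i) = front (suc i)
  g (middle zero) = front zero
  g (middle (suc zero)) = back zero
  g (middle (suc (suc c))) = middle c
  g (back i) = back (suc i)

-- Brings two colliding vertices to the middle slots that `pairOff` consumes. The inner `insert`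
-- places `q` among the values other than `p`.
permutation-01 : {p q : Fin (2 + m)} → p ≢ q →
  Σ (Permutation′ (2 + m)) λ π → (π Perm.⟨$⟩ʳ zero ≡ p) × (π Perm.⟨$⟩ʳ suc zero ≡ q)
permutation-01 {p = p} {q} p≢q = insert zero p σ , refl ,
  trans (insert-punchIn zero p σ zero) (punchIn-punchOut p≢q)
  where
  σ : Permutation′ _
  σ = insert zero (punchOut p≢q) Perm.id

-- Finite codes and least witnesses

funToFin-injective : {f g : Fin m → Fin n} → funToFin f ≡ funToFin g → f ≗ g
funToFin-injective {f = f} {g} eq i =
  trans (sym (finToFun-funToFin f i)) (trans (cong (λ c → finToFun c i) eq) (finToFun-funToFin g i))

bit : Bool → Fin 2
bit = from 2↔Bool

unbit : Fin 2 → Bool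
unbit = to 2↔Bool

unbit-bit : ∀ b → unbit (bit b) ≡ b
unbit-bit = strictlyInverseˡ 2↔Bool

-- Induction on the witness `b`, shifting `P` once zero is ruled out. The bound `c ≤ b` is what
-- later turns one spelling into an estimate of the lettericity.
least : {P : ℕ → Set} → (∀ c → Dec (P c)) → ∀ {b} → P b →
  ∃[ c ] ((P c × (∀ j → P j → c ≤ j)) × c ≤ b)
least P? {zero} Pb = zero , (Pb , λ _ _ → z≤n) , z≤n
least P? {suc b} Pb with P? zero
... | yes P0 = zero , (P0 , λ _ _ → z≤n) , z≤n
... | no ¬P0 with least (P? ∘ suc) Pb
...   | c , (Pc , min) , c≤b = suc c , (Pc , min′) , s≤s c≤b
  where
  min′ : ∀ j → _ → suc c ≤ j
  min′ zero P0 = contradiction P0 ¬P0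
  min′ (suc j) Pj = s≤s (min j Pj)

-- Words that spell a graph

module _ {V : Set} (G : Graph V) where
  open Graph G

  ~-swap : ∀ {u v} → (u ~ v) ⇔ (v ~ u)
  ~-swap = mk⇔ ~-sym ~-sym

  -- Pairs with `p < q` suffice, since symmetry and irreflexivity settle the others. Bijectivity of
  -- `f` is supplied separately.
  Spells : Decoder A → Vector A N → (Fin N → V) → Set
  Spells D w f = ∀ p q → p < q → (f p ~ f q) ⇔ T (D (w p , w q))

  Spells? : (D : Decoder A) (w : Vector A N) (f : Fin N → V) → Dec (Spells D w f)
  Spells? D w f = all? λ p → all? λ q → (p <? q) →-dec
    map′ (λ (g , h) → mk⇔ g h) (λ e → Equivalence.to e , Equivalence.from e)
      (((f p ~? f q) →-dec T? _) ×-dec (T? _ →-dec (f p ~? f q)))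

  -- Stands in for function extensionality: decoding a code returns the original function only
  -- pointwise.
  Spells-resp : {D D′ : Decoder A} {w w′ : Vector A N} {f f′ : Fin N → V} →
    D ≗ D′ → w ≗ w′ → f ≗ f′ → Spells D w f → Spells D′ w′ f′
  Spells-resp {D = D} {D′} {w} D≗ w≗ f≗ spells p q p<q =
    subst₂ _⇔_ (cong₂ _~_ (f≗ p) (f≗ q))
      (cong T (trans (cong₂ (λ a b → D (a , b)) (w≗ p) (w≗ q)) (D≗ _)))
      (spells p q p<q)

  spells⇒≅ : (D : Decoder A) (w : Vector A N) (φ : Fin N ↔ V) →
    Spells D w (to φ) → G ≅ letterGraph D w
  spells⇒≅ D w φ spells = record
    { bijection = ↔-sym φ
    ; ~⇔~ = λ u v → subst₂ (λ x y → (x ~ y) ⇔ (from φ u L.~ from φ v))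
        (strictlyInverseˡ φ u) (strictlyInverseˡ φ v) (edge (from φ u) (from φ v))
    }
    where
    module L = Graph (letterGraph D w)
    edge : ∀ p q → (to φ p ~ to φ q) ⇔ (p L.~ q)
    edge p q with <-cmp p q
    ... | tri< p<q _ q≮p = mk⇔ (λ e → inj₁ (p<q , Equivalence.to (spells p q p<q) e))
      λ { (inj₁ (_ , t)) → Equivalence.from (spells p q p<q) t
        ; (inj₂ (q<p , _)) → contradiction q<p q≮p }
    ... | tri≈ _ refl _ = mk⇔ (λ e → contradiction e ~-irr) (λ e → contradiction e L.~-irr)
    ... | tri> p≮q _ q<p = mk⇔ (λ e → inj₂ (q<p , Equivalence.to (spells q p q<p) (~-sym e)))
      λ { (inj₁ (p<q , _)) → contradiction p<q p≮q
        ; (inj₂ (_ , t)) → ~-sym (Equivalence.from (spells q p q<p) t) }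

  ≅⇒spells : (D : Decoder A) (w : Vector A N) (iso : G ≅ letterGraph D w) →
    Spells D w (_≅_.from iso)
  ≅⇒spells D w iso p q p<q = mk⇔
    (λ e → [ proj₂ , (λ (q<p , _) → contradiction q<p (ℕ.<-asym p<q)) ]
      (subst₂ L._~_ (inv p) (inv q) (Equivalence.to edge e)))
    (λ t → Equivalence.from edge (subst₂ L._~_ (sym (inv p)) (sym (inv q)) (inj₁ (p<q , t))))
    where
    module L = Graph (letterGraph D w)
    inv = strictlyInverseˡ (_≅_.bijection iso)
    edge = _≅_.~⇔~ iso (_≅_.from iso p) (_≅_.from iso q)


  -- Deciding whether a given number of letters suffices

  isLetterGraph? : V ↔ Fin n → ∀ c → Dec (IsLetterGraph c G)
  isLetterGraph? {n} φ c = map′ sound complete search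
    where
    -- A bijection is split into two mutually inverse functions, so that every datum of the search
    -- is a function between finite sets and has a numerical code.
    Presents : Decoder (Fin c) → Vector (Fin c) n → (f g : Fin n → Fin n) → Set
    Presents D w f g =
      (∀ i → f (g i) ≡ i) × (∀ i → g (f i) ≡ i) × Spells D w (from φ ∘ f)

    Presents? : ∀ D w f g → Dec (Presents D w f g)
    Presents? D w f g =
      all? (λ i → f (g i) ≟ i) ×-dec all? (λ i → g (f i) ≟ i) ×-dec Spells? D w (from φ ∘ f)

    decoder : (Fin (c * c) → Fin 2) → Decoder (Fin c)
    decoder d (a , b) = unbit (d (combine a b))

    encode : Decoder (Fin c) → Fin (c * c) → Fin 2
    encode D = bit ∘ D ∘ remQuot c

    decoder-encode : ∀ D → D ≗ decoder (finToFun (funToFin (encode D)))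
    decoder-encode D (a , b) = sym (trans (cong unbit (finToFun-funToFin (encode D) (combine a b)))
      (trans (unbit-bit _) (cong D (remQuot-combine a b))))

    search = any? λ (d : Fin (2 ^ (c * c))) → any? λ (w : Fin (c ^ n)) →
      any? λ (f : Fin (n ^ n)) → any? λ (g : Fin (n ^ n)) →
      Presents? (decoder (finToFun d)) (finToFun w) (finToFun f) (finToFun g)

    sound : _ → IsLetterGraph c G
    sound (d , w , f , g , fg , gf , spells) = n , decoder (finToFun d) , finToFun w ,
      spells⇒≅ (decoder (finToFun d)) (finToFun w)
        (↔-trans (mk↔ₛ′ (finToFun f) (finToFun g) fg gf) (↔-sym φ)) spells

    complete : IsLetterGraph c G → _
    -- The isomorphism forces the word to have length `n`, so searching words of that length is
    -- exhaustive.
    complete (n′ , D , w , iso) with ↔⇒≡ (↔-trans (↔-sym φ) (_≅_.bijection iso))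
    ... | refl = funToFin (encode D) , funToFin w , funToFin f , funToFin g ,
      inverse f g (strictlyInverseˡ ψ) , inverse g f (strictlyInverseʳ ψ) ,
      Spells-resp (decoder-encode D) (λ i → sym (finToFun-funToFin w i))
        (λ i → trans (sym (strictlyInverseʳ φ _)) (cong (from φ) (sym (finToFun-funToFin f i))))
        (≅⇒spells D w iso)
      where
      ψ = ↔-trans (↔-sym (_≅_.bijection iso)) φ
      f = to ψ
      g = from ψ
      inverse : ∀ (f g : Fin n → Fin n) → (∀ i → f (g i) ≡ i) →
        ∀ i → finToFun (funToFin f) (finToFun (funToFin g) i) ≡ i
      inverse f g fg i = trans (finToFun-funToFin f _)
        (trans (cong f (finToFun-funToFin g i)) (fg i))

  -- Choosing nested pairs by the pigeonhole principle

  -- Pair `j` consists of twins as seen from pair `i`, where `≺` is the order of choice. It is a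
  -- parameter because the construction uses `_>_` and the word `_<_`.
  Nested : Rel (Fin k) _ → (Slot k m → V) → Set
  Nested _≺_ F = ∀ {i j} → i ≺ j →
    ((F (front i) ~ F (front j)) ⇔ (F (front i) ~ F (back j))) ×
    ((F (back i) ~ F (front j)) ⇔ (F (back i) ~ F (back j)))

  equalAdjacency : ∀ {u v w} → bit (isYes (w ~? u)) ≡ bit (isYes (w ~? v)) → (w ~ u) ⇔ (w ~ v)
  equalAdjacency {u} {v} {w} eq = mk⇔
    (λ e → toWitness (subst T eq′ (fromWitness e)))
    (λ e → toWitness (subst T (sym eq′) (fromWitness e)))
    where
    eq′ : isYes (w ~? u) ≡ isYes (w ~? v)
    eq′ = trans (sym (unbit-bit _)) (trans (cong unbit eq) (unbit-bit _))

  -- The front and the back vertices of the `k` pairs each contribute a factor `2 ^ k` to the number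
  -- of neighbourhoods, so two of the `2 + m` middle vertices agree on all pairs.
  nested-extend : 2 ^ k * 2 ^ k ℕ.< 2 + m →
    (Σ (Slot k (2 + m) ↔ V) λ e → Nested _>_ (to e)) →
    Σ (Slot (suc k) m ↔ V) λ e → Nested _>_ (to e)
  nested-extend {k} {m} bound (e , nested) = e′ , nested′
    where
    adjacency : (Fin k → Slot k (2 + m)) → Fin (2 + m) → Fin k → Fin 2
    adjacency side c i = bit (isYes (to e (side i) ~? to e (middle c)))

    neighbourhood : Fin (2 + m) → Fin (2 ^ k * 2 ^ k)
    neighbourhood c = combine (funToFin (adjacency front c)) (funToFin (adjacency back c))

    collision = pigeonhole bound neighbourhood
    p = proj₁ collision
    q = proj₁ (proj₂ collision)
    same = combine-injective _ _ _ _ (proj₂ (proj₂ (proj₂ collision)))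
    permuted = permutation-01 (<⇒≢ (proj₁ (proj₂ (proj₂ collision))))
    π = proj₁ permuted

    e′ : Slot (suc k) m ↔ V
    e′ = ↔-trans pairOff (↔-trans (permuteMiddle π) e)

    twins : ∀ side → funToFin (adjacency side p) ≡ funToFin (adjacency side q) → ∀ i →
      (to e (side i) ~ to e (middle (π Perm.⟨$⟩ʳ zero))) ⇔
      (to e (side i) ~ to e (middle (π Perm.⟨$⟩ʳ suc zero)))
    twins side eq i = subst₂
      (λ a b → (to e (side i) ~ to e (middle a)) ⇔ (to e (side i) ~ to e (middle b)))
      (sym (proj₁ (proj₂ permuted))) (sym (proj₂ (proj₂ permuted)))
      (equalAdjacency (funToFin-injective eq i))

    nested′ : Nested _>_ (to e′)
    -- Zero is never the larger index, so the new pair only has to be twins over the old ones.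
    nested′ {suc i} {zero} _ = twins front (proj₁ same) i , twins back (proj₂ same) i
    nested′ {suc i} {suc j} (s≤s i>j) = nested i>j

  -- The bound is that of the last extension, made when `k ∸ 1` pairs are present. Earlier
  -- extensions are easier: fewer pairs and two more middle vertices each time.
  nested-decreasing : ∀ k m → 2 ^ (k ∸ 1) * 2 ^ (k ∸ 1) ℕ.< 2 + m → n ≡ k + (m + k) → V ↔ Fin n →
    Σ (Slot k m ↔ V) λ e → Nested _>_ (to e)
  nested-decreasing zero m _ refl φ = ↔-trans (↔-sym slot↔) (↔-sym φ) , λ { {()} }
  nested-decreasing (suc k) m bound size φ = nested-extend bound
    (nested-decreasing k (2 + m)
      (ℕ.≤-<-trans (ℕ.*-mono-≤ mono mono) (ℕ.<-≤-trans bound (ℕ.m≤n+m (2 + m) 2)))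
      (trans size (shift k m)) φ)
    where
    mono : 2 ^ (k ∸ 1) ≤ 2 ^ k
    mono = ℕ.^-monoʳ-≤ 2 (ℕ.m∸n≤m k 1)

    shift : ∀ k m → suc k + (m + suc k) ≡ k + (2 + m + k)
    shift = solve-∀

  nested-increasing : ∀ k m → 2 ^ (k ∸ 1) * 2 ^ (k ∸ 1) ℕ.< 2 + m → n ≡ k + (m + k) → V ↔ Fin n →
    Σ (Slot k m ↔ V) λ e → Nested _<_ (to e)
  nested-increasing k m bound size φ with nested-decreasing k m bound size φ
  ... | e , nested = ↔-trans reverseOuter e , λ i<j → nested (opposite-anti-< i<j)

  -- From nested pairs to spellings

  -- Every front slot precedes every back slot, so for two paired letters the edge between `front i`
  -- and `back j` forces this value.
  slotDecoder : (A → Fin k ⊎ Fin m) → (Slot k m → V) → Decoder A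
  slotDecoder f F (a , b) = isYes (F (first (f a)) ~? F (last (f b)))

  -- Two fronts: nestedness moves the later one to its back twin. Two backs: the left one has the
  -- larger index, and nestedness with symmetry moves it to its front twin. The other cases are
  -- already in the required form or out of order.
  nested-edge : {F : Slot k m → V} → Nested _<_ F → ∀ s t → position s < position t →
    (F s ~ F t) ⇔ (F (first (letter s)) ~ F (last (letter t)))
  nested-edge nested (front i) (front j) lt = proj₁ (nested (↑ˡ-cancel-< lt))
  nested-edge nested (front i) (middle d) lt = ⇔.refl
  nested-edge nested (front i) (back j) lt = ⇔.refl
  nested-edge nested (middle c) (front j) lt = contradiction lt ↑ʳ≮↑ˡ
  nested-edge nested (middle c) (middle d) lt = ⇔.refl
  nested-edge nested (middle c) (back j) lt = ⇔.refl
  nested-edge nested (back i) (front j) lt = contradiction lt ↑ʳ≮↑ˡ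
  nested-edge {k} nested (back i) (middle d) lt = contradiction (↑ʳ-cancel-< k lt) ↑ʳ≮↑ˡ
  nested-edge {k} {m} nested (back i) (back j) lt =
    ⇔.trans ~-swap (⇔.trans (⇔.sym (proj₂ (nested j<i))) ~-swap)
    where j<i = opposite-cancel-< (↑ʳ-cancel-< m (↑ʳ-cancel-< k lt))

  -- Generic in the alphabet through `f`, to serve both the whole graph (`splitAt k`) and the nested
  -- word without middle letters (`inj₁`).
  nested-spells : {F : Slot k m → V} → Nested _<_ F →
    (f : A → Fin k ⊎ Fin m) (w : Vector A (k + (m + k))) → (∀ p → f (w p) ≡ letter (slot p)) →
    Spells (slotDecoder f F) w (F ∘ slot)
  nested-spells {k = k} {m} {F = F} nested f w eq p q p<q rewrite eq p | eq q =
    ⇔.trans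
      (nested-edge {F = F} nested (slot p) (slot q)
        (subst₂ _<_ (sym (position-slot {k} {m} p)) (sym (position-slot {k} {m} q)) p<q))
      (mk⇔ fromWitness toWitness)

  nested⇒isLetterGraph : (e : Slot k m ↔ V) → Nested _<_ (to e) → IsLetterGraph (k + m) G
  nested⇒isLetterGraph {k} {m} e nested = k + (m + k) , slotDecoder (splitAt k) (to e) , w ,
    spells⇒≅ (slotDecoder (splitAt k) (to e)) w (↔-trans slot↔ e)
      (nested-spells {F = to e} nested (splitAt k) w (λ p → splitAt-join k m (letter (slot p))))
    where
    w : Vector (Fin (k + m)) (k + (m + k))
    w p = join k m (letter (slot p))

-- The subgraph induced on the outer slots

isOuter : Slot k m → Bool
isOuter (front _) = true
isOuter (middle _) = false
isOuter (back _) = true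

outer↔ : Slot k 0 ↔ ⟦ isOuter {k} {m} ⟧
outer↔ = mk↔ₛ′
  (λ { (front i) → front i , _ ; (back i) → back i , _ })
  (λ { (front i , _) → front i ; (back i , _) → back i })
  (λ { (front i , _) → refl ; (back i , _) → refl })
  (λ { (front i) → refl ; (back i) → refl })

restrict↔ : (e : A ↔ V) (S : A → Bool) → ⟦ S ⟧ ↔ ⟦ S ∘ from e ⟧
restrict↔ e S = mk↔ₛ′
  (λ (a , t) → to e a , subst (T ∘ S) (sym (strictlyInverseʳ e a)) t)
  (λ (v , t) → from e v , t)
  (λ (v , t) → ⟦⟧-≡ (strictlyInverseˡ e v))
  (λ (a , t) → ⟦⟧-≡ (strictlyInverseʳ e a))
  where
  ⟦⟧-≡ : ∀ {B : Set} {R : B → Bool} {x y : ⟦ R ⟧} → proj₁ x ≡ proj₁ y → x ≡ y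
  ⟦⟧-≡ {x = b , t} {.b , t′} refl = cong (b ,_) (T-irrelevant t t′)

nestedWord-letter : ∀ k (p : Fin (k + k)) → inj₁ (nestedWord k p) ≡ letter (slot {k} {0} p)
nestedWord-letter k p with splitAt k p
... | inj₁ i = refl
... | inj₂ j = refl

nested⇒nestedWord : (G : Graph V) (e : Slot k m ↔ V) → Nested G _<_ (to e) →
  Σ (V → Bool) λ S → (⟦ S ⟧ ↔ Fin (k + k)) ×
    (Σ (Decoder (Fin k)) λ D → G [ S ] ≅ letterGraph D (nestedWord k))
nested⇒nestedWord {V} {k} {m} G e nested =
  S , ↔-sym (↔-trans slot↔ φ) , D ,
  spells⇒≅ (G [ S ]) D (nestedWord k) (↔-trans slot↔ φ)
    -- `nested` carries over unchanged: `φ` agrees with `e` on fronts and backs, and `G [ S ]`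
    -- compares first projections.
    (nested-spells (G [ S ]) {F = to φ} nested inj₁ (nestedWord k) (nestedWord-letter k))
  where
  S : V → Bool
  S = isOuter ∘ from e

  φ : Slot k 0 ↔ ⟦ S ⟧
  φ = ↔-trans outer↔ (restrict↔ e isOuter)

  D : Decoder (Fin k)
  D = slotDecoder (G [ S ]) inj₁ (to φ)

theorem3p2p3 : (k n : ℕ) → k ≥ 1 →
    {V : Set} (G : Graph V) → V ↔ Fin n →
    n ≥ 2 * (k ∸ 1) + 2 ^ (2 * (k ∸ 1)) + 1 →
    (Σ (V → Bool) λ S → (⟦ S ⟧ ↔ Fin (2 * k)) ×
    (Σ (Decoder (Fin k)) λ D → G [ S ] ≅ letterGraph D (nestedWord k)))
    × (∃[ c ] (Lettericity G c × c ≤ n ∸ k))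
theorem3p2p3 (suc k) n _ {V} G φ n≥ =
  subst (λ N → Σ (V → Bool) λ S → (⟦ S ⟧ ↔ Fin N) ×
      (Σ (Decoder (Fin (suc k))) λ D → G [ S ] ≅ letterGraph D (nestedWord (suc k))))
    (double (suc k))
    (nested⇒nestedWord G e nested) ,
  least (isLetterGraph? G φ)
    (subst (λ c → IsLetterGraph c G) letters (nested⇒isLetterGraph G e nested))
  where
  -- From here `k` is one less than the number of pairs, and `r` counts the vertices outside the
  -- pairs.
  r = n ∸ 2 * suc k

  double : ∀ k → k + k ≡ 2 * k
  double = solve-∀

  arrange₁ : ∀ k x → 2 * k + x + 1 ≡ 2 * k + (1 + x)
  arrange₁ = solve-∀

  arrange₂ : ∀ k m → m + 2 * suc k ≡ 2 * k + (2 + m)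
  arrange₂ = solve-∀

  arrange₃ : ∀ k m → m + 2 * k ≡ k + (m + k)
  arrange₃ = solve-∀

  large : 2 * k + (1 + 2 ^ (2 * k)) ≤ n
  large = subst (_≤ n) (arrange₁ k (2 ^ (2 * k))) n≥

  -- The summand `2 ^ (2 * k)` is at least 1, which together with the final 1 leaves room for the
  -- last pair.
  fits : 2 * suc k ≤ n
  fits = ℕ.≤-trans (subst (_≤ 2 * k + (1 + 2 ^ (2 * k))) (sym (arrange₂ k 0))
    (ℕ.+-monoʳ-≤ (2 * k) (s≤s (ℕ.m^n>0 2 (2 * k))))) large

  n≡ : n ≡ r + 2 * suc k
  n≡ = sym (ℕ.m∸n+n≡m fits)

  -- Removing the `2 * k` vertices of the first `k` pairs leaves `2 + r`, at least one more than the
  -- `2 ^ (2 * k)` possible neighbourhoods.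
  bound : 2 ^ k * 2 ^ k ℕ.< 2 + r
  bound = subst (ℕ._< 2 + r)
    (trans (cong (2 ^_) (sym (double k))) (ℕ.^-distribˡ-+-* 2 k k))
    (ℕ.+-cancelˡ-≤ (2 * k) _ _ (subst (_ ≤_) (trans n≡ (arrange₂ k r)) large))

  size : n ≡ suc k + (r + suc k)
  size = trans n≡ (arrange₃ (suc k) r)

  nesting = nested-increasing G (suc k) r bound size φ
  e = proj₁ nesting
  nested = proj₂ nesting

  letters : suc k + r ≡ n ∸ suc k
  letters = sym (trans (cong (_∸ suc k) (trans size (sym (ℕ.+-assoc (suc k) r (suc k)))))
    (ℕ.m+n∸n≡m (suc k + r) (suc k)))
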